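{- The reduced logogram $|Log_{CNF}(SAT)|$ does not contain wizards. That is, for all positive integers $n, m$, writing $E = CNF^{nm}$, $F = SAT^{nm}$, letting $y_1,\dots,y_{2^n}$ be the truth assignments to the $n$ variables and $F_i \subseteq F$ the set of words in $E$ encoding formulas satisfied by $y_i$ (so $F = F_1 \cup \dots \cup F_{2^n}$), no element of $|Log_E(F)|$ belongs to $$Log_E(F_1 \cup \dots \cup F_{2^n}) \setminus \bigl(Log_E(F_1) \cup \dots \cup Log_E(F_{2^n})\bigr).$$
   Context: Let $\Sigma$ be a finite alphabet and $N$ the set of positive integers. A string over $\Sigma$ is a partial function $N \to \Sigma$ with finite domain; $\Sigma_\infty$ is the set of all strings. A word over $\Sigma$ is identified with the string whose domain is an initial segment $\{1,\dots,\ell\}$ of $N$. For strings $f, g$, write $f \le g$ (equivalently $g \ge f$; "$g$ includes $f$") if $Dom(f) \subseteq Dom(g)$ and $g$ agrees with $f$ on $Dom(f)$. For a set of words $E$, $\Sigma_\infty(E)$ is the set of strings $g$ such that some $x \in E$ satisfies $x \ge g$. For $H \subseteq \Sigma_\infty(E)$, $E^H = \{x \in E : \exists a \in H,\ x \ge a\}$. For $F \subseteq E$ the logogram is $Log_E(F) = \{g \in \Sigma_\infty(E) : \forall x \in E\ (x \ge g \Rightarrow x \in E^F)\}$, where $F$ is viewed as a set of strings. The reduced logogram $|Log_E(F)|$ is the set of $\le$-minimal elements of $Log_E(F)$, i.e. those that do not include any other element of $Log_E(F)$. When $F = F_1 \cup \dots \cup F_k$, the strings in $Log_E(F_1) \cup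 \dots \cup Log_E(F_k)$ are called witnesses, and the strings in $Log_E(F_1 \cup \dots \cup F_k) \setminus (Log_E(F_1) \cup \dots \cup Log_E(F_k))$ are called wizards. Encoding of CNF: $\Sigma = \{0,1,2\}$. A clause over variables $v_1,\dots,v_n$ is encoded as a word of length $n$ over $\Sigma$, where the $k$-th letter is $0$ if $v_k$ does not occur, $1$ if the literal $v_k$ occurs, $2$ if the literal $\neg v_k$ occurs. A formula with $n$ variables and $m$ clauses is encoded as the concatenation of its $m$ clause codes. $CNF^{nm}$ is the set of all words of length $nm$ over $\{0,1,2\}$, each regarded as such a formula (an all-zero block is the empty, hence unsatisfiable, clause), and $SAT^{nm}$ is the set of those words in $CNF^{nm}$ encoding satisfiable formulas. -}

module Defs where

open import Level using (0ℓ)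
open import Data.Bool.Base using (Bool; true; false)
open import Data.Fin.Base using (Fin; zero; suc)
open import Data.List.Base using (List; []; _∷_; length)
open import Data.Maybe.Base using (Maybe; just; nothing)
open import Data.Nat.Base using (ℕ; zero; suc; _*_; _≤_; s≤s)
open import Data.Product.Base using (_×_; _,_; ∃-syntax; Σ-syntax)
open import Data.Vec.Base using (Vec; lookup; concat; toList)
open import Data.Vec.Relation.Unary.All using (All)
open import Relation.Binary.PropositionalEquality.Core using (_≡_; refl)
open import Relation.Unary using (Pred; _∈_; _⊆_; _∖_; ⋃)

-- Positions are counted from 0: the natural number i stands for the
-- positive integer i + 1.
record Str (A : Set) : Set where
  field
    at     : ℕ → Maybe A
    finite : ∃[ b ] (∀ i → b ≤ i → at i ≡ nothing)

open Str public

module _ {A : Set} where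

  Dom : Str A → Pred ℕ 0ℓ
  Dom f i = ∃[ a ] at f i ≡ just a

  infix 4 _≼_ _≈_

  _≼_ : Str A → Str A → Set
  f ≼ g = Dom f ⊆ Dom g × (∀ i → i ∈ Dom f → at g i ≡ at f i)

  -- Equality of strings as partial functions.
  _≈_ : Str A → Str A → Set
  f ≈ g = ∀ i → at f i ≡ at g i

  letterAt : List A → ℕ → Maybe A
  letterAt []       i       = nothing
  letterAt (a ∷ w)  zero    = just a
  letterAt (a ∷ w)  (suc i) = letterAt w i

  letterAt-finite : (w : List A) → ∀ i → length w ≤ i → letterAt w i ≡ nothing
  letterAt-finite []      i       _       = refl
  letterAt-finite (a ∷ w) (suc i) (s≤s p) = letterAt-finite w i p

  ⟦_⟧ : List A → Str A
  ⟦ w ⟧ = record { at = letterAt w ; finite = length w , letterAt-finite w }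

  asStrings : Pred (List A) 0ℓ → Pred (Str A) 0ℓ
  asStrings F f = ∃[ w ] w ∈ F × f ≈ ⟦ w ⟧

  -- Σ_∞(E)
  Substrings : Pred (List A) 0ℓ → Pred (Str A) 0ℓ
  Substrings E g = ∃[ x ] x ∈ E × g ≼ ⟦ x ⟧

  -- E^H
  _↾_ : Pred (List A) 0ℓ → Pred (Str A) 0ℓ → Pred (List A) 0ℓ
  (E ↾ H) x = x ∈ E × ∃[ a ] a ∈ H × a ≼ ⟦ x ⟧

  Log : (E F : Pred (List A) 0ℓ) → Pred (Str A) 0ℓ
  Log E F g = g ∈ Substrings E ×
              (∀ x → x ∈ E → g ≼ ⟦ x ⟧ → x ∈ (E ↾ asStrings F))

  ReducedLog : (E F : Pred (List A) 0ℓ) → Pred (Str A) 0ℓ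
  ReducedLog E F g = g ∈ Log E F ×
                     (∀ h → h ∈ Log E F → h ≼ g → h ≈ g)

  Witnesses : {I : Set} (E : Pred (List A) 0ℓ) (F : I → Pred (List A) 0ℓ) →
              Pred (Str A) 0ℓ
  Witnesses {I} E F = ⋃ I (λ i → Log E (F i))

  Wizards : {I : Set} (E : Pred (List A) 0ℓ) (F : I → Pred (List A) 0ℓ) →
            Pred (Str A) 0ℓ
  Wizards {I} E F = Log E (⋃ I F) ∖ Witnesses E F

Assignment : ℕ → Set
Assignment n = Vec Bool n

data Literal (n : ℕ) : Set where
  pos neg : Fin n → Literal n

Holds : ∀ {n} → Assignment n → Pred (Literal n) 0ℓ
Holds y (pos k) = lookup y k ≡ true
Holds y (neg k) = lookup y k ≡ false

ClauseCode : ℕ → Set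
ClauseCode n = Vec (Fin 3) n

FormulaCode : ℕ → ℕ → Set
FormulaCode n m = Vec (ClauseCode n) m

-- The set of literals occurring in the clause with the given code.
literals : ∀ {n} → ClauseCode n → Pred (Literal n) 0ℓ
literals c (pos k) = lookup c k ≡ suc zero
literals c (neg k) = lookup c k ≡ suc (suc zero)

SatisfiesClause : ∀ {n} → Assignment n → Pred (ClauseCode n) 0ℓ
SatisfiesClause y c = ∃[ l ] l ∈ literals c × l ∈ Holds y

Satisfies : ∀ {n m} → Assignment n → Pred (FormulaCode n m) 0ℓ
Satisfies y φ = All (SatisfiesClause y) φ

CNF : ℕ → ℕ → Pred (List (Fin 3)) 0ℓ
CNF n m w = length w ≡ n * m

SatisfiedBy : ∀ n m → Assignment n → Pred (List (Fin 3)) 0ℓ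
SatisfiedBy n m y w =
  w ∈ CNF n m × Σ[ φ ∈ FormulaCode n m ] toList (concat φ) ≡ w × φ ∈ Satisfies y

SAT : ∀ n m → Pred (List (Fin 3)) 0ℓ
SAT n m w =
  w ∈ CNF n m × Σ[ φ ∈ FormulaCode n m ] toList (concat φ) ≡ w × (∃[ y ] φ ∈ Satisfies y)

{-# OPTIONS --safe #-}

-- Let every completion of g be satisfiable, and complete g by zeros. An assignment y
-- satisfying this completion makes a literal true in each clause; its letter is nonzero,
-- hence belongs to g. So y satisfies all completions of g, and g is a witness.
module Submission where

open import Defs
open import Data.Fin.Base using (Fin; zero; suc; toℕ; combine)
open import Data.List.Base using (List; _∷_; length; applyUpTo)
open import Data.List.Properties using (length-applyUpTo)
open import Data.Maybe.Base using (just; nothing; fromMaybe)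
open import Data.Maybe.Properties using (just-injective)
open import Data.Nat.Base using (ℕ; zero; suc; _*_; _^_; _<_; z<s; s<s; NonZero)
open import Data.Nat.Properties using (*-comm)
open import Data.Product.Base using (_,_; ∃-syntax)
open import Data.Vec.Base using (Vec; _∷_; lookup; concat; toList; fromList; cast; group)
open import Data.Vec.Properties using (lookup-concat; toList-cast; toList∘fromList)
import Data.Vec.Relation.Unary.All.Properties as All
open import Function.Base using (_∘_; id)
open import Function.Bundles using (_⤖_; module Bijection)
open import Relation.Binary.PropositionalEquality
  using (_≡_; _≢_; refl; sym; trans; cong; subst)
open import Relation.Nullary.Negation.Core using (contradiction)
open import Relation.Unary using (_∈_; _∉_)

module _ {A : Set} where

  ≼-refl : (f : Str A) → f ≼ f
  ≼-refl _ = id , λ _ _ → refl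

  ≼⇒at : (f g : Str A) → f ≼ g → ∀ {i a} → at f i ≡ just a → at g i ≡ just a
  ≼⇒at _ _ (_ , agree) {i} {a} p = trans (agree i (a , p)) p

  at⇒≼ : (f g : Str A) → (∀ {i a} → at f i ≡ just a → at g i ≡ just a) → f ≼ g
  at⇒≼ _ _ h = (λ (a , p) → a , h p) , λ i (_ , p) → trans (h p) (sym p)

  letterAt-just⇒< : (w : List A) {i : ℕ} {a : A} → letterAt w i ≡ just a → i < length w
  letterAt-just⇒< (_ ∷ w) {zero}  _ = z<s
  letterAt-just⇒< (_ ∷ w) {suc i} p = s<s (letterAt-just⇒< w p)

  letterAt-applyUpTo : (f : ℕ → A) {l i : ℕ} → i < l →
                       letterAt (applyUpTo f l) i ≡ just (f i)
  letterAt-applyUpTo f {suc l} {zero}  _       = refl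
  letterAt-applyUpTo f {suc l} {suc i} (s<s p) = letterAt-applyUpTo (f ∘ suc) p

  letterAt-toList : ∀ {l} (v : Vec A l) i → letterAt (toList v) (toℕ i) ≡ just (lookup v i)
  letterAt-toList (_ ∷ v) zero    = refl
  letterAt-toList (_ ∷ v) (suc i) = letterAt-toList v i

  -- The value of `combine j k` is `n * j + k`, the position, counted from 0, of letter `k` of block
  -- `j`. This links the coordinates of clauses to the positions on which strings are compared.
  letterAt-concat : ∀ {n m} (φ : Vec (Vec A n) m) j k →
                    letterAt (toList (concat φ)) (toℕ (combine j k)) ≡ just (lookup (lookup φ j) k)
  letterAt-concat φ j k =
    trans (letterAt-toList (concat φ) (combine j k)) (cong just (lookup-concat φ j k))

  split : ∀ n m (w : List A) → length w ≡ n * m → ∃[ φ ] toList (concat {m = n} {n = m} φ) ≡ w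
  -- Concatenating `m` blocks of length `n` gives the length `m * n`, while `p` speaks of `n * m`;
  -- hence the `cast`.
  split n m w p with group m n (cast (trans p (*-comm n m)) (fromList w))
  ... | φ , q = φ , trans (cong toList (sym q))
                      (trans (toList-cast _ (fromList w)) (toList∘fromList w))

  complete : A → ℕ → Str A → List A
  complete d l g = applyUpTo (fromMaybe d ∘ at g) l

  -- Cutting at `length x` loses nothing of `g`: as `x` includes `g`, every position in the domain
  -- of `g` lies below that length.
  ≼-complete : ∀ d (g : Str A) (x : List A) → g ≼ ⟦ x ⟧ → g ≼ ⟦ complete d (length x) g ⟧
  ≼-complete d g x g≼x = at⇒≼ g ⟦ complete d (length x) g ⟧ λ p →
    trans (letterAt-applyUpTo _ (letterAt-just⇒< x (≼⇒at g ⟦ x ⟧ g≼x p)))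
          (cong (just ∘ fromMaybe d) p)

  -- Filling inserts only `d`, so any other letter must come from `g`. The bound on `i` comes from
  -- the existence of a letter there.
  complete-reflects : ∀ {d} l (g : Str A) {i a} → a ≢ d →
                      letterAt (complete d l g) i ≡ just a → at g i ≡ just a
  complete-reflects {d} l g {i} a≢d p
    with at g i | just-injective (trans (sym p) (letterAt-applyUpTo _
                    (subst (i <_) (length-applyUpTo _ l) (letterAt-just⇒< (complete d l g) p))))
  ... | just _  | eq = cong just (sym eq)
  ... | nothing | eq = contradiction eq a≢d

-- Only nonzero letters encode literals, so a true literal of `c` still occurs in `d`; further
-- literals in `d` do no harm to a disjunction.
satisfiesClause-mono : ∀ {n} {y : Assignment n} {c d : ClauseCode n} →
  (∀ k {a} → a ≢ zero → lookup c k ≡ a → lookup d k ≡ a) →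
  SatisfiesClause y c → SatisfiesClause y d
satisfiesClause-mono h (pos k , occ , holds) = pos k , h k (λ ()) occ , holds
satisfiesClause-mono h (neg k , occ , holds) = neg k , h k (λ ()) occ , holds

-- The hypothesis compares flat words because inclusion of strings gives information in that form;
-- `letterAt-concat` translates it clause by clause.
satisfies-mono : ∀ {n m} {y : Assignment n} (φ ψ : FormulaCode n m) →
  (∀ {i a} → a ≢ zero →
    letterAt (toList (concat φ)) i ≡ just a → letterAt (toList (concat ψ)) i ≡ just a) →
  Satisfies y φ → Satisfies y ψ
satisfies-mono φ ψ h sat = All.lookup⁻ λ j →
  satisfiesClause-mono
    (λ k a≢0 p → just-injective (trans (sym (letterAt-concat ψ j k))
      (h a≢0 (trans (letterAt-concat φ j k) (cong just p)))))
    (All.lookup⁺ sat j)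

Log-SAT⇒Log-SatisfiedBy : ∀ n m g → g ∈ Log (CNF n m) (SAT n m) →
                          ∃[ y ] g ∈ Log (CNF n m) (SatisfiedBy n m y)
Log-SAT⇒Log-SatisfiedBy n m g ((x , |x|≡nm , g≼x) , log)
  with log (complete zero (length x) g) (trans (length-applyUpTo _ (length x)) |x|≡nm) (≼-complete zero g x g≼x)
... | _ , f , (_ , (_ , φ , refl , y , sat) , f≈φ) , f≼x₀ =
  y , (x , |x|≡nm , g≼x) , λ w w∈E g≼w →
    let ψ , ψ≡w = split n m w w∈E
        -- A nonzero letter of `φ` passes to `f`, to the zero completion, back to `g`, and on to
        -- `w`, which `ψ` encodes. The passage back to `g` is where `a≢0` enters.
        mono : ∀ {i a} → a ≢ zero → letterAt (toList (concat φ)) i ≡ just a →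
               letterAt (toList (concat ψ)) i ≡ just a
        mono {i} a≢0 p = trans (cong (λ v → letterAt v i) ψ≡w)
          (≼⇒at g ⟦ w ⟧ g≼w (complete-reflects (length x) g a≢0
            (≼⇒at f ⟦ complete zero (length x) g ⟧ f≼x₀ (trans (f≈φ i) p))))
    in w∈E , ⟦ w ⟧ , (w , (w∈E , ψ , ψ≡w , satisfies-mono φ ψ mono sat) , λ _ → refl) , ≼-refl ⟦ w ⟧

theorem9 : (n m : ℕ) .{{_ : NonZero n}} .{{_ : NonZero m}} →
    (y : Fin (2 ^ n) ⤖ Assignment n) →
    ∀ g → g ∈ ReducedLog (CNF n m) (SAT n m) →
    g ∉ Wizards (CNF n m) (λ i → SatisfiedBy n m (Bijection.to y i))
theorem9 n m y g (g∈Log , _) (_ , g∉Witnesses)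
  with Log-SAT⇒Log-SatisfiedBy n m g g∈Log
-- Witnesses are indexed by `Fin (2 ^ n)`, so the assignment `z` has to be traced back to its index
-- in the enumeration `y`.
... | z , g∈Log-z with Bijection.strictlySurjective y z
... | i , refl = g∉Witnesses (i , g∈Log-z)
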